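{- Let $T$ be a complete binary tree on $2^n-1$ vertices, let $\lambda$ be a $2$-periodic 1-labeling of $T$, and let $\mathcal{T}=(T,\lambda)$. Then $2^{n-3}\le M_2(\mathcal{T})\le 2^{n-2}$. Both bounds are tight.
   Context: The complete binary tree on $2^n-1$ vertices is the rooted binary tree in which every non-leaf vertex has exactly two children and all $2^{n-1}$ leaves are at distance $n-1$ from the root. For a positive integer $p$, a $p$-periodic 1-labeling $\lambda$ of a finite simple undirected graph $G=(V,E)$ assigns to each edge $e$ an infinite set of time-steps of the form $\{i,i+p,i+2p,\dots\}$ with $i\in\{1,\dots,p\}$ (so each edge is present exactly once in every $p$ consecutive time-steps). In the temporal graph $\mathcal{G}=(G,\lambda)$, a journey from $u$ to $v$ is a path in $G$ from $u$ to $v$ together with a choice, for each edge of the path, of a time-step in its label set so that the chosen time-steps are strictly increasing along the path. The temporal distance $\mathrm{dist}_t(u,v)$ is the smallest time-step at which a journey from $u$ reaches $v$ (with $\mathrm{dist}_t(u,u)=0$, and $\infty$ if there is no journey). A set $R\subseteq V$ is a temporal resolving set if (i) for every $v\in V$ there is a journey from some $s\in R$ to $v$ (every vertex is reached from itself), and (ii) for every two distinct $u,v\in V$ there is $s\in R$ with $\mathrm{dist}_t(s,u)\neq\mathrm{dist}_t(s,v)$. $M_p(\mathcal{G})$ denotes the minimum size of a temporal resolving set of $\mathcal{G}$ when $\lambda$ is a $p$-periodic 1-labeling.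
   Formalization: The bounds are stated for n ≥ 2, since for n = 1 the single-vertex tree has M_2 = 1 > 2^{n-2} = 1/2; tightness of the lower bound is stated for every n ≥ 3 (at n = 2 it would be 1/2) and of the upper bound for every n ≥ 2. -}

module Defs where

open import Data.Bool.Base using (Bool; true; false)
open import Data.Fin.Base using (Fin; zero; suc; toℕ)
open import Data.Fin.Properties using (+↔⊎)
open import Data.List.Base using (List; []; _∷_; length)
open import Data.List.Membership.Propositional using (_∈_; _∉_)
open import Data.List.Relation.Unary.Unique.Propositional using (Unique)
open import Data.Maybe.Base using (Maybe; just; nothing)
open import Data.Nat.Base using (ℕ; zero; suc; _+_; _*_; _∸_; _^_; _≤_; _<_)
open import Data.Nat.Properties using (+-identityʳ; +-suc)
open import Data.Product.Base using (∃-syntax; _×_; _,_)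
open import Data.Sum.Base using (_⊎_; inj₁; inj₂; swap)
open import Data.Sum.Function.Propositional using (_⊎-↔_)
open import Function.Bundles using (_↔_; mk↔ₛ′)
open import Function.Construct.Composition using (_↔-∘_)
open import Function.Construct.Identity using (↔-id)
open import Function.Construct.Symmetry using (↔-sym)
open import Relation.Binary.PropositionalEquality
  using (_≡_; _≢_; refl; sym; trans; cong; cong₂; subst)
open import Relation.Nullary using (¬_)

record FiniteSimpleGraph : Set₁ where
  field
    V       : Set
    order   : ℕ
    finite  : V ↔ Fin order
    Adj     : V → V → Set
    adj-sym : ∀ {u v} → Adj u v → Adj v u
    irrefl  : ∀ {v} → ¬ Adj v v

-- `label e = j` stands for the residue i = 1 + j ∈ {1,…,p}.  The condition
-- `undirected` makes the label depend only on the unordered pair {u , v}: it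
-- relates every proof of `Adj u v` to every proof of `Adj v u`.
record PeriodicLabeling (G : FiniteSimpleGraph) (p : ℕ) : Set where
  open FiniteSimpleGraph G
  field
    label      : ∀ {u v} → Adj u v → Fin p
    undirected : ∀ {u v} (e : Adj u v) (e′ : Adj v u) → label e ≡ label e′

module Temporal {G : FiniteSimpleGraph} {p : ℕ} (ℓ : PeriodicLabeling G p) where
  open FiniteSimpleGraph G
  open PeriodicLabeling ℓ

  ActiveAt : ∀ {u v} → Adj u v → ℕ → Set
  ActiveAt e t = ∃[ k ] t ≡ suc (toℕ (label e)) + k * p

  -- `Journey s v ws t`: a journey from s arriving at v at time t, where ws lists
  -- the vertices of the underlying path, last one first.  All time-steps are at
  -- least 1, so starting the empty journey at time 0 does not restrict the first
  -- step.
  data Journey (s : V) : V → List V → ℕ → Set where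
    stay : Journey s s (s ∷ []) 0
    step : ∀ {u v ws t t′} → Journey s u ws t → (e : Adj u v) → v ∉ ws →
           t < t′ → ActiveAt e t′ → Journey s v (v ∷ ws) t′

  Reaches : V → V → ℕ → Set
  Reaches s v t = ∃[ ws ] Journey s v ws t

  -- The temporal distance as a functional relation; `nothing` is ∞.
  TemporalDistance : V → V → Maybe ℕ → Set
  TemporalDistance s v (just t) = Reaches s v t × (∀ t′ → Reaches s v t′ → t ≤ t′)
  TemporalDistance s v nothing  = ∀ t → ¬ Reaches s v t

  Separates : V → V → V → Set
  Separates s u v =
    ∃[ d ] ∃[ d′ ] TemporalDistance s u d × TemporalDistance s v d′ × d ≢ d′

  record Resolving (R : List V) : Set where
    field
      reached   : ∀ v → ∃[ s ] s ∈ R × ∃[ t ] Reaches s v t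
      separated : ∀ u v → u ≢ v → ∃[ s ] s ∈ R × Separates s u v

-- `MetricDimension ℓ m`: m is the minimum size of a temporal resolving set, a
-- set of vertices being a duplicate-free list.
record MetricDimension {G : FiniteSimpleGraph} {p : ℕ}
                       (ℓ : PeriodicLabeling G p) (m : ℕ) : Set where
  open FiniteSimpleGraph G
  open Temporal ℓ
  field
    attained : ∃[ R ] Unique R × Resolving R × length R ≡ m
    minimal  : ∀ (R : List V) → Unique R → Resolving R → m ≤ length R

-- Vertices of the complete binary tree with n levels: paths down from the root.
data Node : ℕ → Set where
  root  : ∀ {n} → Node (suc n)
  below : ∀ {n} → Bool → Node n → Node (suc n)

-- `Child u v`: v is one of the two children of u.
data Child : ∀ {n} → Node n → Node n → Set where
  here  : ∀ {n} (b : Bool) → Child {suc (suc n)} root (below b root)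
  there : ∀ {n} (b : Bool) {u v : Node n} → Child u v → Child (below b u) (below b v)

nodeCount : ℕ → ℕ
nodeCount zero    = 0
nodeCount (suc n) = suc (nodeCount n + nodeCount n)

suc-nodeCount : ∀ n → suc (nodeCount n) ≡ 2 ^ n
suc-nodeCount zero    = refl
suc-nodeCount (suc n) =
  trans (cong suc (sym (+-suc (nodeCount n) (nodeCount n))))
        (cong₂ _+_ (suc-nodeCount n)
                   (trans (suc-nodeCount n) (sym (+-identityʳ (2 ^ n)))))

Node-suc↔ : ∀ n → Node (suc n) ↔ (Fin 1 ⊎ (Node n ⊎ Node n))
Node-suc↔ n = mk↔ₛ′ to from to-from from-to
  where
  to : Node (suc n) → Fin 1 ⊎ (Node n ⊎ Node n)
  to root            = inj₁ zero
  to (below false v) = inj₂ (inj₁ v)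
  to (below true  v) = inj₂ (inj₂ v)

  from : Fin 1 ⊎ (Node n ⊎ Node n) → Node (suc n)
  from (inj₁ _)        = root
  from (inj₂ (inj₁ v)) = below false v
  from (inj₂ (inj₂ v)) = below true v

  to-from : ∀ x → to (from x) ≡ x
  to-from (inj₁ zero)     = refl
  to-from (inj₂ (inj₁ _)) = refl
  to-from (inj₂ (inj₂ _)) = refl

  from-to : ∀ v → from (to v) ≡ v
  from-to root            = refl
  from-to (below false _) = refl
  from-to (below true  _) = refl

Node↔Fin : ∀ n → Node n ↔ Fin (nodeCount n)
Node↔Fin zero    = mk↔ₛ′ (λ ()) (λ ()) (λ ()) (λ ())
Node↔Fin (suc n) =
  (↔-sym (+↔⊎ {1}) ↔-∘ (↔-id (Fin 1) ⊎-↔ (↔-sym +↔⊎ ↔-∘ (Node↔Fin n ⊎-↔ Node↔Fin n))))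
    ↔-∘ Node-suc↔ n

Child-irrefl : ∀ {n} {v : Node n} → ¬ Child v v
Child-irrefl (there _ c) = Child-irrefl c

completeBinaryTree : ℕ → FiniteSimpleGraph
completeBinaryTree n = record
  { V       = Node n
  ; order   = 2 ^ n ∸ 1
  ; finite  = subst (λ k → Node n ↔ Fin k) (cong (_∸ 1) (suc-nodeCount n)) (Node↔Fin n)
  ; Adj     = λ u v → Child u v ⊎ Child v u
  ; adj-sym = swap
  ; irrefl  = λ { (inj₁ c) → Child-irrefl c ; (inj₂ c) → Child-irrefl c }
  }

{-# OPTIONS --safe #-}
module Submission where

-- With period 2 an edge is crossed within two steps of reaching it, and in a tree the
-- temporal distance is computed along the unique path.
--
-- Lower bound: cut the tree into its 2^(n-3) lowest subtrees of height 3.  Every journey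
-- entering such a subtree T uses the edge above its root, so the parity c of its entry
-- time t is the same for all sources outside T.  Either two sibling leaves of T have
-- equal labels, or both children of the root of T have a child whose edge is not
-- labelled c, and such leaves are reached at time t + 3 regardless of the edges between.
-- In both cases two leaves of T are not separated from outside, so T contains a source.
-- When all labels are equal, sibling leaves clash, and subtrees of height 2 suffice.
--
-- Upper bounds: put one leaf of every lowest subtree of height 2 (or, if each edge is
-- labelled by the side of its lower end, of height 3) into R.  Such a source separates
-- its own subtree, and reaches it so early that anything of at least the same depth on
-- the other side of a branching comes later.

open import Defs
open import Data.Bool.Base using (Bool; true; false; if_then_else_)
open import Data.Fin.Base using (Fin; zero; suc; toℕ)
open import Data.Fin.Patterns using (0F; 1F)
import Data.Fin.Properties as Fin
open import Data.List.Base using (List; []; _∷_; _++_; length; map; mapMaybe)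
open import Data.List.Membership.Propositional using (_∈_; find; lose)
open import Data.List.Membership.Propositional.Properties
  using (∈-map⁺; ∈-map⁻; ∈-++⁺ˡ; ∈-++⁺ʳ; ∈-length)
open import Data.List.Properties using (length-map; length-++)
open import Data.List.Relation.Unary.All as All using (All; []; _∷_)
open import Data.List.Relation.Unary.Any as Any using (Any; here; there)
import Data.List.Relation.Unary.Any.Properties as Any
open import Data.List.Relation.Unary.Unique.Propositional using (Unique; []; _∷_)
import Data.List.Relation.Unary.Unique.DecPropositional as DecUnique
import Data.List.Relation.Unary.Unique.Propositional.Properties as Unique
open import Data.Maybe.Base using (Maybe; just; nothing)
open import Data.Maybe.Properties using (just-injective)
import Data.Maybe.Relation.Unary.Any as Maybe
open import Data.Nat.Base using (ℕ; zero; suc; _+_; _*_; _∸_; _^_; _≤_; _<_; z≤n; s≤s)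
open import Data.Nat.Induction using (<-wellFounded)
open import Data.Nat.Properties
open import Data.Product.Base using (_×_; ∃-syntax; _,_; proj₁; proj₂)
open import Data.Sum.Base using (_⊎_; inj₁; inj₂)
open import Data.Unit.Base using (⊤; tt)
open import Data.Vec.Base using (Vec; []; _∷_; toList; replicate)
open import Function.Base using (_∘_)
open import Function.Bundles using (Inverse)
open import Function.Properties.Inverse using (↔⇒↣)
open import Induction.WellFounded using (Acc; acc)
open import Relation.Binary.Definitions using (DecidableEquality)
open import Relation.Binary.PropositionalEquality
  using (_≡_; _≢_; refl; sym; trans; cong; cong₂; subst; module ≡-Reasoning)
open import Relation.Nullary using (¬_; Dec; yes; no; contradiction; ¬?)
open import Relation.Nullary.Decidable using (map′; _×-dec_; _→-dec_)

-- Distances in an arbitrary periodic temporal graph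

module _ {G : FiniteSimpleGraph} where
  open FiniteSimpleGraph G

  _≟ⱽ_ : DecidableEquality V
  _≟ⱽ_ = Fin.inj⇒≟ (↔⇒↣ finite)

  any-vertex? : {P : V → Set} → (∀ v → Dec (P v)) → Dec (∃[ v ] P v)
  any-vertex? {P} P? =
    map′ (λ (i , p) → from i , p)
         (λ (v , p) → to v , subst P (sym (strictlyInverseʳ v)) p)
         (Fin.any? (P? ∘ from))
    where open Inverse finite

  all-vertices? : {P : V → Set} → (∀ v → Dec (P v)) → Dec (∀ v → P v)
  all-vertices? {P} P? =
    map′ (λ f v → subst P (strictlyInverseʳ v) (f (to v))) (_∘ from)
         (Fin.all? (P? ∘ from))
    where open Inverse finite

  any-list? : ∀ k {P : List V → Set} → (∀ R → Dec (P R)) →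
              Dec (∃[ R ] P R × length R ≡ k)
  any-list? zero P? = map′ (λ p → [] , p , refl) (λ { ([] , p , _) → p }) (P? [])
  any-list? (suc k) P? =
    map′ (λ (v , R , p , eq) → v ∷ R , p , cong suc eq)
         (λ { (v ∷ R , p , eq) → v , R , p , suc-injective eq })
         (any-vertex? λ v → any-list? k λ R → P? (v ∷ R))

  module _ {p} (ℓ : PeriodicLabeling G p) where
    open PeriodicLabeling ℓ
    open Temporal ℓ

    -- A shortest-path certificate: by `relaxed` no journey arrives before `d`, and following
    -- `predecessor` back to `s` gives a journey that arrives exactly then.
    module _ (d : V → ℕ) (s : V) (d-source : d s ≡ 0)
             (relaxed : ∀ {u v t} (e : Adj u v) → d u < t → ActiveAt e t → d v ≤ t)
             (predecessor : ∀ v → s ≢ v →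
                ∃[ u ] ∃[ e ] d u < d v × ActiveAt {u} {v} e (d v)) where

      journey-late : ∀ {v ws t} → Journey s v ws t → d v ≤ t
      journey-late stay               = ≤-reflexive d-source
      journey-late (step j e _ t<t′ a) = relaxed e (≤-<-trans (journey-late j) t<t′) a

      -- Times drop strictly along predecessors, so the recursion ends. The bound on all visited
      -- vertices shows that `v`, having a larger `d`, is not yet on the path to its predecessor.
      foremost-journey : ∀ v → Acc _<_ (d v) →
        ∃[ ws ] Journey s v ws (d v) × All (λ w → d w ≤ d v) ws
      foremost-journey v (acc rec) with s ≟ⱽ v
      ... | yes refl = s ∷ [] , subst (Journey s s (s ∷ [])) (sym d-source) stay , ≤-refl ∷ []
      ... | no s≢v =
        let u , e , du<dv , active = predecessor v s≢v
            ws , j , near = foremost-journey u (rec du<dv)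
        in v ∷ ws
         , step j e (λ v∈ws → <⇒≱ du<dv (All.lookup near v∈ws)) du<dv active
         , ≤-refl ∷ All.map (λ dw≤du → ≤-trans dw≤du (<⇒≤ du<dv)) near

      bellman : ∀ v → TemporalDistance s v (just (d v))
      bellman v = let ws , j , _ = foremost-journey v (<-wellFounded _)
                  in (ws , j) , λ { t (_ , j′) → journey-late j′ }

    module _ (d : V → V → ℕ) (correct : ∀ s v → TemporalDistance s v (just (d s v))) where

      distance-unique : ∀ {s v x} → TemporalDistance s v x → x ≡ just (d s v)
      distance-unique {s} {v} {just t} (r , least) =
        cong just (≤-antisym (least _ (proj₁ (correct s v))) (proj₂ (correct s v) _ r))
      distance-unique {s} {v} {nothing} unreachable =
        contradiction (proj₁ (correct s v)) (unreachable _)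

      separates⁺ : ∀ {s u v} → d s u ≢ d s v → Separates s u v
      separates⁺ {s} {u} {v} ne =
        _ , _ , correct s u , correct s v , ne ∘ just-injective

      separates⁻ : ∀ {s u v} → Separates s u v → d s u ≢ d s v
      separates⁻ (x , y , du , dv , ne) eq =
        ne (trans (distance-unique du) (trans (cong just eq) (sym (distance-unique dv))))

      resolving? : ∀ R → Dec (Resolving R)
      resolving? R =
        map′ (λ (r , s) → record { reached = r ; separated = s })
             (λ R-res → Resolving.reached R-res , Resolving.separated R-res)
             (all-vertices? (λ v → some? λ s → yes (d s v , proj₁ (correct s v)))
              ×-dec
              all-vertices? λ u → all-vertices? λ v → ¬? (u ≟ⱽ v) →-dec
                some? λ s → map′ separates⁺ separates⁻ (¬? (d s u ≟ d s v)))
        where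
        some? : {P : V → Set} → (∀ s → Dec (P s)) → Dec (∃[ s ] s ∈ R × P s)
        some? P? = map′ find (λ (_ , s∈R , p) → lose s∈R p) (Any.any? P? R)

      -- Being resolving is decidable and each length has finitely many lists, so one can pass to a
      -- strictly shorter resolving list until none exists; the last one is minimum.
      metricDimension-≤ : ∀ R → Unique R → Resolving R →
        ∃[ m ] MetricDimension ℓ m × m ≤ length R
      metricDimension-≤ R₀ = search R₀ (<-wellFounded _)
        where
        open DecUnique _≟ⱽ_ using (unique?)

        search : ∀ R → Acc _<_ (length R) → Unique R → Resolving R →
          ∃[ m ] MetricDimension ℓ m × m ≤ length R
        search R (acc rec) R-unique R-res
          with anyUpTo? (λ k → any-list? k λ R → unique? R ×-dec resolving? R) (length R)
        ... | yes (_ , k<R , R′ , (R′-unique , R′-res) , refl) =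
          let m , m-dim , m≤k = search R′ (rec k<R) R′-unique R′-res
          in m , m-dim , ≤-trans m≤k (<⇒≤ k<R)
        ... | no none = length R , record
          { attained = R , R-unique , R-res , refl
          ; minimal  = λ R′ R′-unique R′-res → ≮⇒≥ λ R′<R →
              none (length R′ , R′<R , R′ , (R′-unique , R′-res) , refl)
          } , ≤-refl

-- Two time residues

Active : Fin 2 → ℕ → Set
Active c t = ∃[ k ] t ≡ suc (toℕ c) + k * 2

-- The first time after `t` at which an edge labelled `c` is present. Shifting time by one exchanges
-- the two residues, whence the mutual pattern of the clauses.
next : Fin 2 → ℕ → ℕ
next 0F zero    = 1
next 1F zero    = 2
next 0F (suc t) = suc (next 1F t)
next 1F (suc t) = suc (next 0F t)

next-active : ∀ c t → Active c (next c t)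
next-active 0F zero = 0 , refl
next-active 1F zero = 0 , refl
next-active 0F (suc t) = let k , eq = next-active 1F t in suc k , cong suc eq
next-active 1F (suc t) = let k , eq = next-active 0F t in k , cong suc eq

t<next : ∀ c t → t < next c t
t<next 0F zero    = s≤s z≤n
t<next 1F zero    = s≤s z≤n
t<next 0F (suc t) = s≤s (t<next 1F t)
t<next 1F (suc t) = s≤s (t<next 0F t)

next≤2+t : ∀ c t → next c t ≤ 2 + t
next≤2+t 0F zero    = s≤s z≤n
next≤2+t 1F zero    = ≤-refl
next≤2+t 0F (suc t) = s≤s (next≤2+t 1F t)
next≤2+t 1F (suc t) = s≤s (next≤2+t 0F t)

next-least : ∀ c {t t′} → t < t′ → Active c t′ → next c t ≤ t′
next-least 0F {zero}  t<t′ _ = t<t′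
next-least 1F {zero}  _ (k , refl) = s≤s (s≤s z≤n)
next-least 0F {suc t} (s≤s ()) (zero , refl)
next-least 0F {suc t} (s≤s t<t′) (suc k , refl) = s≤s (next-least 1F t<t′ (k , refl))
next-least 1F {suc t} (s≤s t<t′) (k , refl) = s≤s (next-least 0F t<t′ (k , refl))

-- Whatever the middle label is, waiting costs one extra step exactly once.
next-three-later : ∀ c l l′ t → l′ ≢ c → next l′ (next l (next c t)) ≡ 3 + next c t
next-three-later 0F _  0F _ l′≢c = contradiction refl l′≢c
next-three-later 1F _  1F _ l′≢c = contradiction refl l′≢c
next-three-later 0F 0F 1F zero _ = refl
next-three-later 0F 1F 1F zero _ = refl
next-three-later 1F 0F 0F zero _ = refl
next-three-later 1F 1F 0F zero _ = refl
next-three-later 0F 0F 1F (suc t) _ = cong suc (next-three-later 1F 1F 0F t λ ())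
next-three-later 0F 1F 1F (suc t) _ = cong suc (next-three-later 1F 0F 0F t λ ())
next-three-later 1F 0F 0F (suc t) _ = cong suc (next-three-later 0F 1F 1F t λ ())
next-three-later 1F 1F 0F (suc t) _ = cong suc (next-three-later 0F 0F 1F t λ ())

-- Distances in the tree

address : ∀ {n} → Node n → List Bool
address root        = []
address (below b v) = b ∷ address v

depth : ∀ {n} → Node n → ℕ
depth v = length (address v)

-- The edge above a vertex is labelled by the address of that vertex; the value at
-- the empty address is junk.
Labels : Set
Labels = List Bool → Fin 2

_↓_ : Labels → Bool → Labels
(L ↓ b) bs = L (b ∷ bs)

up : ∀ {n} → Labels → Node n → ℕ
up L root        = 0
up L (below b s) = next (L (b ∷ [])) (up (L ↓ b) s)

down : ∀ {n} → Labels → ℕ → Node n → ℕ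
down L t root        = t
down L t (below b v) = down (L ↓ b) (next (L (b ∷ [])) t) v

-- Stripping the common prefix of the addresses leads to the lowest common ancestor; the path climbs
-- to it and then descends.
dist : ∀ {n} → Labels → Node n → Node n → ℕ
dist L (below false s) (below false v) = dist (L ↓ false) s v
dist L (below true s)  (below true v)  = dist (L ↓ true) s v
dist L s v = down L (up L s) v

dist-root : ∀ {n} L (s : Node (suc n)) → dist L s root ≡ up L s
dist-root L root            = refl
dist-root L (below false s) = refl
dist-root L (below true s)  = refl

dist-refl : ∀ {n} L (s : Node n) → dist L s s ≡ 0
dist-refl L root            = refl
dist-refl L (below false s) = dist-refl (L ↓ false) s
dist-refl L (below true s)  = dist-refl (L ↓ true) s

depth+t≤down : ∀ {n} L t (v : Node n) → depth v + t ≤ down L t v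
depth+t≤down L t root = ≤-refl
depth+t≤down L t (below b v) = ≤-trans
  (≤-trans (≤-reflexive (sym (+-suc (depth v) t)))
           (+-monoʳ-≤ (depth v) (t<next (L (b ∷ [])) t)))
  (depth+t≤down (L ↓ b) (next (L (b ∷ [])) t) v)

down-child : ∀ {n} L t {u v : Node n} → Child u v →
             down L t v ≡ next (L (address v)) (down L t u)
down-child L t (here b)    = refl
down-child L t (there b c) = down-child (L ↓ b) _ c

-- In a tree, the path from `s` to the farther end of an edge runs through the nearer end and uses
-- that edge last.
dist-edge : ∀ {n} L s {u v : Node n} → Child u v →
  dist L s v ≡ next (L (address v)) (dist L s u) ⊎
  dist L s u ≡ next (L (address v)) (dist L s v)
dist-edge L root (here b) = inj₁ refl
dist-edge L root (there b c) = inj₁ (down-child (L ↓ b) _ c)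
dist-edge L (below false s) (here false) = inj₂ (cong (next _) (sym (dist-root _ s)))
dist-edge L (below true s)  (here true)  = inj₂ (cong (next _) (sym (dist-root _ s)))
dist-edge L (below false s) (here true)  = inj₁ refl
dist-edge L (below true s)  (here false) = inj₁ refl
dist-edge L (below false s) (there false c) = dist-edge (L ↓ false) s c
dist-edge L (below true s)  (there true c)  = dist-edge (L ↓ true) s c
dist-edge L (below false s) (there true c)  = inj₁ (down-child (L ↓ true) _ c)
dist-edge L (below true s)  (there false c) = inj₁ (down-child (L ↓ false) _ c)

parent : ∀ {n} b (v : Node n) → ∃[ u ] Child u (below b v)
parent b root         = root , here b
parent b (below b′ v) = let u , c = parent b′ v in below b u , there b c


data Predecessor {n} (L : Labels) (s v : Node n) : Set where
  above-v : ∀ {u} → Child u v → dist L s v ≡ next (L (address v)) (dist L s u) →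
            Predecessor L s v
  below-v : ∀ {u} → Child v u → dist L s v ≡ next (L (address u)) (dist L s u) →
            Predecessor L s v

predecessor-below : ∀ {n} b {L} {s v : Node n} →
  Predecessor (L ↓ b) s v → Predecessor L (below b s) (below b v)
predecessor-below false (above-v c eq) = above-v (there false c) eq
predecessor-below false (below-v c eq) = below-v (there false c) eq
predecessor-below true  (above-v c eq) = above-v (there true c) eq
predecessor-below true  (below-v c eq) = below-v (there true c) eq

predecessor : ∀ {n} L (s v : Node n) → s ≢ v → Predecessor L s v
predecessor L root root s≢v = contradiction refl s≢v
predecessor L root (below b root) _ = above-v (here b) refl
predecessor L root (below b (below b′ v)) _ =
  let u , c = parent b′ v in above-v (there b c) (down-child (L ↓ b) _ c)
predecessor L (below false root) root _ = below-v (here false) refl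
predecessor L (below true root) root _ = below-v (here true) refl
predecessor L (below false s@(below _ _)) root _ =
  below-v (here false) (cong (next _) (sym (dist-root (L ↓ false) s)))
predecessor L (below true s@(below _ _)) root _ =
  below-v (here true) (cong (next _) (sym (dist-root (L ↓ true) s)))
predecessor L (below false s) (below false v) s≢v =
  predecessor-below false (predecessor (L ↓ false) s v (s≢v ∘ cong (below false)))
predecessor L (below true s) (below true v) s≢v =
  predecessor-below true (predecessor (L ↓ true) s v (s≢v ∘ cong (below true)))
predecessor L (below false s) (below true root) _ = above-v (here true) refl
predecessor L (below true s) (below false root) _ = above-v (here false) refl
predecessor L (below false s) (below true (below b v)) _ =
  let u , c = parent b v in above-v (there true c) (down-child (L ↓ true) _ c)
predecessor L (below true s) (below false (below b v)) _ =
  let u , c = parent b v in above-v (there false c) (down-child (L ↓ false) _ c)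

-- Labelings of the tree as functions of addresses

Labeling : ℕ → Set
Labeling n = PeriodicLabeling (completeBinaryTree n) 2

_LabelledBy_ : ∀ {n} → Labeling n → Labels → Set
ℓ LabelledBy L = ∀ {u v} (c : Child u v) → PeriodicLabeling.label ℓ (inj₁ c) ≡ L (address v)

module _ {n} {ℓ : Labeling n} {L : Labels} (ℓ~L : ℓ LabelledBy L) where
  open PeriodicLabeling ℓ
  open Temporal ℓ

  label-up : ∀ {u v} (c : Child u v) → label (inj₂ c) ≡ L (address v)
  label-up c = trans (sym (undirected (inj₁ c) (inj₂ c))) (ℓ~L c)

  dist-relaxed : ∀ s {u v t} (e : Child u v ⊎ Child v u) →
                 dist L s u < t → ActiveAt e t → dist L s v ≤ t
  dist-relaxed s (inj₁ c) u<t a with dist-edge L s c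
  ... | inj₁ eq = ≤-trans (≤-reflexive eq)
                    (next-least _ u<t (subst (λ l → Active l _) (ℓ~L c) a))
  -- Here `v` lies on the path from `s` to `u`, so it is reached even before `u`.
  ... | inj₂ eq = <⇒≤ (<-trans (≤-trans (t<next _ _) (≤-reflexive (sym eq))) u<t)
  dist-relaxed s (inj₂ c) u<t a with dist-edge L s c
  ... | inj₂ eq = ≤-trans (≤-reflexive eq)
                    (next-least _ u<t (subst (λ l → Active l _) (label-up c) a))
  ... | inj₁ eq = <⇒≤ (<-trans (≤-trans (t<next _ _) (≤-reflexive (sym eq))) u<t)

  dist-attained : ∀ s v → s ≢ v →
    ∃[ u ] ∃[ e ] dist L s u < dist L s v × ActiveAt {u} {v} e (dist L s v)
  dist-attained s v s≢v with predecessor L s v s≢v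
  ... | above-v {u} c eq rewrite eq =
    u , inj₁ c , t<next _ _
    , subst (λ l → Active l (next (L (address v)) (dist L s u))) (sym (ℓ~L c)) (next-active _ _)
  ... | below-v {u} c eq rewrite eq =
    u , inj₂ c , t<next _ _
    , subst (λ l → Active l (next (L (address u)) (dist L s u))) (sym (label-up c)) (next-active _ _)

  dist-correct : ∀ s v → TemporalDistance s v (just (dist L s v))
  dist-correct s =
    bellman ℓ (dist L s) s (dist-refl L s) (dist-relaxed s) (dist-attained s)

child-asym : ∀ {n} {u v : Node n} → Child u v → ¬ Child v u
child-asym (there _ c) (there _ c′) = child-asym c c′

labeling : ∀ n → Labels → Labeling n
labeling n L = record { label = label ; undirected = undirected }
  where
  label : {u v : Node n} → Child u v ⊎ Child v u → Fin 2
  label {v = v} (inj₁ _) = L (address v)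
  label {u = u} (inj₂ _) = L (address u)

  undirected : ∀ {u v} (e : Child u v ⊎ Child v u) (e′ : Child v u ⊎ Child u v) →
               label e ≡ label e′
  undirected (inj₁ _) (inj₂ _)  = refl
  undirected (inj₂ _) (inj₁ _)  = refl
  undirected (inj₁ c) (inj₁ c′) = contradiction c′ (child-asym c)
  undirected (inj₂ c) (inj₂ c′) = contradiction c′ (child-asym c)

edgeLabels : ∀ n → ({u v : Node n} → Child u v → Fin 2) → Labels
edgeLabels (suc (suc n)) f (b ∷ [])     = f (here b)
edgeLabels (suc n)       f (b ∷ c ∷ bs) = edgeLabels n (f ∘ there b) (c ∷ bs)
-- Default for the empty address and for addresses that leave the tree.
edgeLabels _             _ _            = 0F

edgeLabels-address : ∀ n (f : {u v : Node n} → Child u v → Fin 2) {u v} (c : Child u v) →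
                     f c ≡ edgeLabels n f (address v)
edgeLabels-address _ f (here b) = refl
-- Splitting `c` exposes the second bit of the address, on which `edgeLabels` must match before it
-- recurses.
edgeLabels-address (suc (suc n)) f (there b c@(here _)) = edgeLabels-address (suc n) (f ∘ there b) c
edgeLabels-address (suc (suc n)) f (there b c@(there _ _)) = edgeLabels-address (suc n) (f ∘ there b) c

-- Blocks: the subtrees of height h in a tree of height k + h

_▷_ : ∀ {k h} → Vec Bool k → Node h → Node (k + h)
[]      ▷ x = x
(b ∷ w) ▷ x = below b (w ▷ x)

_⇓_ : ∀ {k} → Labels → Vec Bool k → Labels
(L ⇓ w) bs = L (toList w ++ bs)

copies : ∀ k {h} → Node h → List (Node (k + h))
copies zero    s = s ∷ []
copies (suc k) s = map (below false) (copies k s) ++ map (below true) (copies k s)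

copies-length : ∀ k {h} (s : Node h) → length (copies k s) ≡ 2 ^ k
copies-length zero    s = refl
copies-length (suc k) s = begin
  length (map (below false) R ++ map (below true) R)
    ≡⟨ length-++ (map (below false) R) ⟩
  length (map (below false) R) + length (map (below true) R)
    ≡⟨ cong₂ _+_ (length-map (below false) R) (length-map (below true) R) ⟩
  length R + length R
    ≡⟨ cong (λ m → m + m) (copies-length k s) ⟩
  2 ^ k + 2 ^ k
    ≡⟨ cong (2 ^ k +_) (sym (+-identityʳ (2 ^ k))) ⟩
  2 ^ suc k ∎
  where
  open ≡-Reasoning
  R = copies k s

copies-unique : ∀ k {h} (s : Node h) → Unique (copies k s)
copies-unique zero    s = [] ∷ []
copies-unique (suc k) s =
  Unique.++⁺ (Unique.map⁺ (λ { refl → refl }) (copies-unique k s))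
             (Unique.map⁺ (λ { refl → refl }) (copies-unique k s))
             disjoint
  where
  disjoint : ∀ {v} → ¬ (v ∈ map (below false) (copies k s) × v ∈ map (below true) (copies k s))
  disjoint (v∈f , v∈t) with ∈-map⁻ (below false) v∈f | ∈-map⁻ (below true) v∈t
  ... | _ , _ , refl | _ , _ , ()

∈-copies : ∀ {k h} (w : Vec Bool k) (s : Node h) → w ▷ s ∈ copies k s
∈-copies []          s = here refl
∈-copies (false ∷ w) s = ∈-++⁺ˡ (∈-map⁺ (below false) (∈-copies w s))
∈-copies (true ∷ w)  s = ∈-++⁺ʳ _ (∈-map⁺ (below true) (∈-copies w s))

-- Upper bounds from one source per block

t<down-below : ∀ {n} L t b (v : Node n) → t < down L t (below b v)
t<down-below L t b v = ≤-trans (s≤s (m≤n+m t (depth v))) (depth+t≤down L t (below b v))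

-- In the application, `x` is the time at which the source reaches the top of its own half, and `d`
-- its distance to `u` there. Crossing to the other half takes two more edges, so `v` is reached no
-- earlier than `x + 2 + depth v`.
near<across : ∀ {n} {c c′ L x d} (u v : Node n) →
  d ≤ x + suc (depth u) → depth u ≤ depth v → d < down L (next c′ (next c x)) v
near<across {c = c} {c′} {L} {x} {d} u v d≤ u≤v = begin-strict
  d                               ≤⟨ d≤ ⟩
  x + suc (depth u)               ≡⟨ +-comm x _ ⟩
  suc (depth u) + x               ≤⟨ +-monoˡ-≤ x (s≤s u≤v) ⟩
  suc (depth v) + x               ≡⟨ sym (+-suc (depth v) x) ⟩
  depth v + suc x                 <⟨ +-monoʳ-< (depth v)
                                       (≤-<-trans (t<next c x) (t<next c′ (next c x))) ⟩
  depth v + next c′ (next c x)    ≤⟨ depth+t≤down L _ v ⟩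
  down L (next c′ (next c x)) v   ∎
  where open ≤-Reasoning

-- The bound `near` survives the passage to larger trees because up grows by at least
-- one per level; it is what makes near<across applicable at every branching.
module _ {h} (s : Node (suc h)) (Admissible : Labels → Set)
         (restrict : ∀ {L} b → Admissible L → Admissible (L ↓ b))
         (near : ∀ {L} → Admissible L → ∀ u → dist L s u ≤ up L s + suc (depth u))
         (injective : ∀ {L} → Admissible L → ∀ {u v} → dist L s u ≡ dist L s v → u ≡ v)
  where

  -- The source is the one in the block of `u`, or in the leftmost block under `u` if `u` lies above
  -- the blocks.
  source-near : ∀ k {L} → Admissible L → (u : Node (k + suc h)) →
    ∃[ w ] dist L (w ▷ s) u ≤ up L (w ▷ s) + suc (depth u)
  source-near zero A u = [] , near A u
  source-near (suc k) {L} A root =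
    w , ≤-trans (≤-reflexive (dist-root L (w ▷ s))) (m≤m+n _ _)
    where w = replicate (suc k) false
  source-near (suc k) A (below false u) =
    let w , le = source-near k (restrict false A) u
    in false ∷ w , ≤-trans le (+-mono-≤ (<⇒≤ (t<next _ _)) (n≤1+n _))
  source-near (suc k) A (below true u) =
    let w , le = source-near k (restrict true A) u
    in true ∷ w , ≤-trans le (+-mono-≤ (<⇒≤ (t<next _ _)) (n≤1+n _))

  sources-separate : ∀ k {L} → Admissible L → {u v : Node (k + suc h)} → u ≢ v →
    ∃[ w ] dist L (w ▷ s) u ≢ dist L (w ▷ s) v
  sources-separate zero A u≢v = [] , u≢v ∘ injective A
  sources-separate (suc k) A {root} {root} u≢v = contradiction refl u≢v
  -- A source in the half that avoids `v` passes the root on its way to `v`.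
  sources-separate (suc k) {L} A {root} {below false v} _ =
    true ∷ w , <⇒≢ (t<down-below L _ false v)
    where w = replicate k false
  sources-separate (suc k) {L} A {root} {below true v} _ =
    false ∷ w , <⇒≢ (t<down-below L _ true v)
    where w = replicate k false
  sources-separate (suc k) {L} A {below false u} {root} _ =
    true ∷ w , >⇒≢ (t<down-below L _ false u)
    where w = replicate k false
  sources-separate (suc k) {L} A {below true u} {root} _ =
    false ∷ w , >⇒≢ (t<down-below L _ true u)
    where w = replicate k false
  sources-separate (suc k) A {below false u} {below false v} u≢v =
    let w , ne = sources-separate k (restrict false A) (u≢v ∘ cong (below false))
    in false ∷ w , ne
  sources-separate (suc k) A {below true u} {below true v} u≢v =
    let w , ne = sources-separate k (restrict true A) (u≢v ∘ cong (below true))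
    in true ∷ w , ne
  -- The source is chosen near the shallower vertex; the other one is then strictly later.
  sources-separate (suc k) A {below false u} {below true v} _ with ≤-total (depth u) (depth v)
  ... | inj₁ u≤v = let w , le = source-near k (restrict false A) u
                   in false ∷ w , <⇒≢ (near<across u v le u≤v)
  ... | inj₂ v≤u = let w , le = source-near k (restrict true A) v
                   in true ∷ w , >⇒≢ (near<across v u le v≤u)
  sources-separate (suc k) A {below true u} {below false v} _ with ≤-total (depth u) (depth v)
  ... | inj₁ u≤v = let w , le = source-near k (restrict true A) u
                   in true ∷ w , <⇒≢ (near<across u v le u≤v)
  ... | inj₂ v≤u = let w , le = source-near k (restrict false A) v
                   in false ∷ w , >⇒≢ (near<across v u le v≤u)

  copies-resolving : ∀ k {L} → Admissible L → {ℓ : Labeling (k + suc h)} → ℓ LabelledBy L →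
    Temporal.Resolving ℓ (copies k s)
  copies-resolving k {L} A {ℓ} ℓ~L = record
    { reached   = λ v → w₀ ▷ s , ∈-copies w₀ s , dist L (w₀ ▷ s) v
                      , proj₁ (dist-correct ℓ~L (w₀ ▷ s) v)
    ; separated = λ u v u≢v →
        let w , ne = sources-separate k A u≢v
        in w ▷ s , ∈-copies w s , separates⁺ ℓ (dist L) (dist-correct ℓ~L) ne
    }
    where w₀ = replicate k false

  dimension-≤ : ∀ k {L} → Admissible L → {ℓ : Labeling (k + suc h)} → ℓ LabelledBy L →
    ∃[ m ] MetricDimension ℓ m × m ≤ 2 ^ k
  dimension-≤ k {L} A {ℓ} ℓ~L =
    subst (λ N → ∃[ m ] MetricDimension ℓ m × m ≤ N) (copies-length k s)
      (metricDimension-≤ ℓ (dist L) (dist-correct ℓ~L)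
         (copies k s) (copies-unique k s) (copies-resolving k A ℓ~L))

-- Lower bounds from clashes in blocks

strip : ∀ {n} → Bool → Node (suc n) → Maybe (Node n)
strip false (below false v) = just v
strip true  (below true v)  = just v
strip _     _               = nothing

branch : ∀ {n} → Bool → List (Node (suc n)) → List (Node n)
branch b = mapMaybe (strip b)

∈-branch : ∀ {n} b {v : Node n} {R} → below b v ∈ R → v ∈ branch b R
∈-branch b {v} {R} v∈R =
  Any.mapMaybe⁺ (strip b) R (Any.map (λ { refl → Maybe.just refl })
    (subst (_∈ map (strip b) R) (strip-below b) (∈-map⁺ (strip b) v∈R)))
  where
  strip-below : ∀ b → strip b (below b v) ≡ just v
  strip-below false = refl
  strip-below true  = refl

branch-length : ∀ {n} (R : List (Node (suc n))) →
                length (branch false R) + length (branch true R) ≤ length R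
branch-length []                = z≤n
branch-length (root ∷ R)          = m≤n⇒m≤1+n (branch-length R)
branch-length (below false _ ∷ R) = s≤s (branch-length R)
branch-length (below true _ ∷ R)  =
  ≤-trans (≤-reflexive (+-suc (length (branch false R)) _)) (s≤s (branch-length R))

-- The two halves of the tree are disjoint and each contains half of the blocks, so the bound
-- doubles with every level.
blocks-≤-length : ∀ k {h} (R : List (Node (k + h))) →
  ((w : Vec Bool k) → ∃[ x ] w ▷ x ∈ R) → 2 ^ k ≤ length R
blocks-≤-length zero    R hit = ∈-length (proj₂ (hit []))
blocks-≤-length (suc k) R hit = begin
  2 ^ k + (2 ^ k + 0)                          ≡⟨ cong (2 ^ k +_) (+-identityʳ (2 ^ k)) ⟩
  2 ^ k + 2 ^ k                                ≤⟨ +-mono-≤ (part false) (part true) ⟩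
  length (branch false R) + length (branch true R) ≤⟨ branch-length R ⟩
  length R                                     ∎
  where
  open ≤-Reasoning
  part : ∀ b → 2 ^ k ≤ length (branch b R)
  part b = blocks-≤-length k (branch b R)
             λ w → let x , x∈R = hit (b ∷ w) in x , ∈-branch b x∈R

-- A journey that enters a block through the edge above its root does so at a time
-- whose parity is the label of that edge.
down-▷ : ∀ {k h} L t b (w : Vec Bool k) → ∃[ t′ ] ∀ (x : Node h) →
  down L t ((b ∷ w) ▷ x) ≡ down (L ⇓ (b ∷ w)) (next (L (b ∷ toList w)) t′) x
down-▷ L t b []      = t , λ _ → refl
down-▷ L t b (c ∷ w) = down-▷ (L ↓ b) _ c w

-- A block contains all descendants of its root, so the edge above that root is the only entrance.
-- Where the address of `s` leaves the prefix `w`, the path turns downwards towards the block.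
enter-block : ∀ {k h} L (w : Vec Bool k) (s : Node (k + h)) →
  (∃[ t ] ∀ x → dist L s (w ▷ x) ≡ down (L ⇓ w) (next (L (toList w)) t) x) ⊎
  (∃[ x ] s ≡ w ▷ x)
enter-block L []          s    = inj₂ (s , refl)
enter-block L (b ∷ w)     root = inj₁ (down-▷ L 0 b w)
enter-block L (false ∷ w) (below true s)  = inj₁ (down-▷ L _ false w)
enter-block L (true ∷ w)  (below false s) = inj₁ (down-▷ L _ true w)
enter-block L (false ∷ w) (below false s) with enter-block (L ↓ false) w s
... | inj₁ entered    = inj₁ entered
... | inj₂ (x , refl) = inj₂ (x , refl)
enter-block L (true ∷ w)  (below true s) with enter-block (L ↓ true) w s
... | inj₁ entered    = inj₁ entered
... | inj₂ (x , refl) = inj₂ (x , refl)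

-- With `c` the label of the edge above a block, every entry time has the form `next c t`. A clash
-- is thus a pair that no source outside the block separates.
Clash : ℕ → Labels → Fin 2 → Set
Clash h L c = ∃[ u ] ∃[ v ] u ≢ v × (∀ t → down {h} L (next c t) u ≡ down {h} L (next c t) v)

-- The clashing pair of a block can be separated only from within, so a resolving set meets every
-- block.
dimension-≥ : ∀ k {h L} {ℓ : Labeling (k + h)} → ℓ LabelledBy L →
  ((w : Vec Bool k) → Clash h (L ⇓ w) (L (toList w))) →
  ∀ {m} → MetricDimension ℓ m → 2 ^ k ≤ m
dimension-≥ k {h} {L} {ℓ} ℓ~L clash m-dim with MetricDimension.attained m-dim
... | R , _ , R-res , refl = blocks-≤-length k R hit
  where
  hit : (w : Vec Bool k) → ∃[ x ] w ▷ x ∈ R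
  hit w with All.decide (enter-block {k} {h} L w) R
  ... | inj₂ some = let s , s∈R , x , s≡wx = find some in x , subst (_∈ R) s≡wx s∈R
  ... | inj₁ none =
    let u , v , u≢v , meet = clash w
        s , s∈R , sep = Temporal.Resolving.separated R-res (w ▷ u) (w ▷ v) (u≢v ∘ ▷-injective w)
        t , enter = All.lookup none s∈R
    in contradiction (trans (enter u) (trans (meet t) (sym (enter v))))
                     (separates⁻ ℓ (dist L) (dist-correct ℓ~L) sep)
    where
    ▷-injective : ∀ {k} (w : Vec Bool k) {x y : Node h} → w ▷ x ≡ w ▷ y → x ≡ y
    ▷-injective []      eq = eq
    ▷-injective (b ∷ w) eq = ▷-injective w (below-injective eq)
      where
      below-injective : ∀ {n b} {x y : Node n} → below b x ≡ below b y → x ≡ y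
      below-injective refl = refl

-- Clashing pairs in subtrees of height 3 and 2

leaf : Bool → Bool → Node 3
leaf b b′ = below b (below b′ root)

-- If the two leaf edges under child `b` have different labels, one of them differs from `c`, and
-- `next-three-later` applies to that leaf.
leaf-three-later : ∀ L c b →
  L (b ∷ false ∷ []) ≡ L (b ∷ true ∷ []) ⊎
  (∃[ b′ ] ∀ t → down L (next c t) (leaf b b′) ≡ 3 + next c t)
leaf-three-later L c b with L (b ∷ false ∷ []) Fin.≟ L (b ∷ true ∷ []) | L (b ∷ false ∷ []) Fin.≟ c
... | yes eq | _        = inj₁ eq
... | no _   | no ne    = inj₂ (false , λ t → next-three-later c (L (b ∷ [])) _ t ne)
... | no ne  | yes refl = inj₂ (true , λ t → next-three-later c (L (b ∷ [])) _ t (ne ∘ sym))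

clash-3 : ∀ L c → Clash 3 L c
clash-3 L c with leaf-three-later L c false | leaf-three-later L c true
... | inj₁ eq | _ =
  leaf false false , leaf false true , (λ ()) , λ t →
    cong (λ l → next l (next (L (false ∷ [])) (next c t))) eq
... | inj₂ _ | inj₁ eq =
  leaf true false , leaf true true , (λ ()) , λ t →
    cong (λ l → next l (next (L (true ∷ [])) (next c t))) eq
... | inj₂ (b , p) | inj₂ (b′ , q) =
  leaf false b , leaf true b′ , (λ ()) , λ t → trans (p t) (sym (q t))

clash-2 : ∀ L c → L (false ∷ []) ≡ L (true ∷ []) → Clash 2 L c
clash-2 L c eq =
  below false root , below true root , (λ ()) , λ t → cong (λ l → next l (next c t)) eq

-- Single leaves that resolve subtrees of height 2 and 3

sibling : Node 2
sibling = below false root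

sibling-near : ∀ L (u : Node 2) → dist L sibling u ≤ up L sibling + suc (depth u)
sibling-near L root = m≤m+n _ _
sibling-near L (below false root) = z≤n
-- Here `suc (depth u)` is 2, exactly the longest wait that period 2 allows.
sibling-near L (below true root) =
  ≤-trans (next≤2+t _ (up L sibling)) (≤-reflexive (+-comm 2 _))

-- The three vertices form a path starting at the source, so their arrival times increase strictly.
sibling-injective : ∀ L (u v : Node 2) → dist L sibling u ≡ dist L sibling v → u ≡ v
sibling-injective L root root _ = refl
sibling-injective L (below false root) (below false root) _ = refl
sibling-injective L (below true root) (below true root) _ = refl
sibling-injective L root (below false root) eq = contradiction eq (>⇒≢ (t<next _ 0))
sibling-injective L root (below true root) eq = contradiction eq (<⇒≢ (t<next _ _))
sibling-injective L (below false root) root eq = contradiction eq (<⇒≢ (t<next _ 0))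
sibling-injective L (below true root) root eq = contradiction eq (>⇒≢ (t<next _ _))
sibling-injective L (below false root) (below true root) eq =
  contradiction eq (<⇒≢ (<-trans (t<next _ 0) (t<next _ _)))
sibling-injective L (below true root) (below false root) eq =
  contradiction eq (>⇒≢ (<-trans (t<next _ 0) (t<next _ _)))

-- The parameter is the value at the empty address. Carrying it along closes the family under `↓`:
-- restricting to a side only replaces `c` by the label of that side.
lastBit : Fin 2 → Labels
lastBit c []       = c
lastBit _ (b ∷ bs) = lastBit (if b then 1F else 0F) bs

corner : Node 3
corner = below false (below false root)

-- The corner reaches the root at time 3. In each clause the first number is the arrival time at `u`
-- and the sum of both is the bound, which the last clause attains.
corner-near : ∀ c (u : Node 3) →
  dist (lastBit c) corner u ≤ up (lastBit c) corner + suc (depth u)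
corner-near c root                            = m≤m+n 3 1
corner-near c (below false root)              = m≤m+n 1 4
corner-near c (below true root)               = m≤m+n 4 1
corner-near c (below false (below false root)) = m≤m+n 0 6
corner-near c (below false (below true root))  = m≤m+n 2 4
corner-near c (below true (below false root))  = m≤m+n 5 1
corner-near c (below true (below true root))   = m≤m+n 6 0

-- The seven vertices are reached from the corner at the times 0, …, 6.
corner-injective : ∀ c (u v : Node 3) →
  dist (lastBit c) corner u ≡ dist (lastBit c) corner v → u ≡ v
corner-injective c u v eq = trans (sym (arrival-dist u)) (trans (cong arrival eq) (arrival-dist v))
  where
  arrival : ℕ → Node 3
  arrival 0 = corner
  arrival 1 = below false root
  arrival 2 = below false (below true root)
  arrival 3 = root
  arrival 4 = below true root
  arrival 5 = below true (below false root)
  arrival _ = below true (below true root)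

  arrival-dist : ∀ u → arrival (dist (lastBit c) corner u) ≡ u
  arrival-dist root                             = refl
  arrival-dist (below false root)               = refl
  arrival-dist (below true root)                = refl
  arrival-dist (below false (below false root)) = refl
  arrival-dist (below false (below true root))  = refl
  arrival-dist (below true (below false root))  = refl
  arrival-dist (below true (below true root))   = refl

-- The two bounds and their tightness

dimension-exact : ∀ {n} {ℓ : Labeling n} {N} → ∃[ m ] MetricDimension ℓ m × m ≤ N →
  (∀ {m} → MetricDimension ℓ m → N ≤ m) → MetricDimension ℓ N
dimension-exact {ℓ = ℓ} (m , m-dim , m≤N) N≤ =
  subst (MetricDimension ℓ) (≤-antisym m≤N (N≤ m-dim)) m-dim

labels : ∀ {n} → Labeling n → Labels
labels {n} ℓ = edgeLabels n (PeriodicLabeling.label ℓ ∘ inj₁)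

labelled : ∀ {n} (ℓ : Labeling n) → ℓ LabelledBy labels ℓ
labelled {n} ℓ = edgeLabels-address n (PeriodicLabeling.label ℓ ∘ inj₁)

upper-bound : ∀ k (ℓ : Labeling (k + 2)) → ∃[ m ] MetricDimension ℓ m × m ≤ 2 ^ k
upper-bound k ℓ =
  dimension-≤ sibling (λ _ → ⊤) (λ _ _ → tt) (λ {L} _ → sibling-near L)
              (λ {L} _ → sibling-injective L _ _) k {labels ℓ} tt (labelled ℓ)

lower-bound : ∀ k (ℓ : Labeling (k + 3)) {m} → MetricDimension ℓ m → 2 ^ k ≤ m
lower-bound k ℓ = dimension-≥ k {L = labels ℓ} (labelled ℓ) (λ w → clash-3 _ _)

lower-tight : ∀ k → ∃[ ℓ ] MetricDimension {completeBinaryTree (k + 3)} {2} ℓ (2 ^ k)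
lower-tight k = ℓ , dimension-exact
  (dimension-≤ corner (λ L → ∃[ c ] L ≡ lastBit c) (λ { b (_ , refl) → _ , refl })
     (λ { (c , refl) → corner-near c }) (λ { (c , refl) → corner-injective c _ _ })
     k (0F , refl) {ℓ} (λ _ → refl))
  (lower-bound k ℓ)
  where ℓ = labeling (k + 3) (lastBit 0F)

upper-tight : ∀ k → ∃[ ℓ ] MetricDimension {completeBinaryTree (k + 2)} {2} ℓ (2 ^ k)
upper-tight k = ℓ , dimension-exact (upper-bound k ℓ)
  -- With constant labels any two sibling leaves clash, so blocks of height 2 already each need a
  -- source.
  (dimension-≥ k {L = λ _ → 0F} {ℓ} (λ _ → refl) (λ _ → clash-2 _ _ refl))
  where ℓ = labeling (k + 2) (λ _ → 0F)

dimension-positive : ∀ {n} {ℓ : Labeling (suc n)} {m} → MetricDimension ℓ m → 1 ≤ m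
dimension-positive m-dim with MetricDimension.attained m-dim
... | R , _ , R-res , refl =
  let _ , s∈R , _ = Temporal.Resolving.reached R-res root in ∈-length s∈R

-- Multiplying by `2 ^ 3` avoids truncated subtraction at `n = 2`, where the bound reads 4 ≤ 8m and
-- follows from the resolving set being nonempty.
lower-bound-8 : ∀ n → 2 ≤ n → (ℓ : Labeling n) → ∀ {m} →
  MetricDimension ℓ m → 2 ^ n ≤ 2 ^ 3 * m
lower-bound-8 2 _ ℓ {m} m-dim = ≤-trans (m≤m+n 4 4) (*-monoʳ-≤ 8 (dimension-positive m-dim))
lower-bound-8 1 (s≤s ()) ℓ m-dim
lower-bound-8 (suc (suc (suc k))) _ ℓ {m} m-dim = begin
  2 ^ (3 + k)    ≡⟨ ^-distribˡ-+-* 2 3 k ⟩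
  2 ^ 3 * 2 ^ k  ≤⟨ *-monoʳ-≤ 8 (bound (+-comm k 3) ℓ m-dim) ⟩
  2 ^ 3 * m      ∎
  where
  open ≤-Reasoning
  bound : ∀ {n} → k + 3 ≡ n → (ℓ : Labeling n) → MetricDimension ℓ m → 2 ^ k ≤ m
  bound refl ℓ = lower-bound k ℓ

theorem17 : (∀ n → 2 ≤ n → (ℓ : PeriodicLabeling (completeBinaryTree n) 2) →
    ∃[ m ] (MetricDimension ℓ m × 2 ^ n ≤ 2 ^ 3 * m × m ≤ 2 ^ (n ∸ 2)))
    × (∀ n → 3 ≤ n →
    ∃[ ℓ ] MetricDimension {completeBinaryTree n} {2} ℓ (2 ^ (n ∸ 3)))
    × (∀ n → 2 ≤ n →
    ∃[ ℓ ] MetricDimension {completeBinaryTree n} {2} ℓ (2 ^ (n ∸ 2)))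
theorem17 =
    (λ n 2≤n ℓ →
       let m , m-dim , m≤ =
             subst (λ n′ → (ℓ : Labeling n′) → ∃[ m ] MetricDimension ℓ m × m ≤ 2 ^ (n ∸ 2))
                   (m∸n+n≡m 2≤n) (upper-bound (n ∸ 2)) ℓ
       in m , m-dim , lower-bound-8 n 2≤n ℓ m-dim , m≤)
  , (λ n 3≤n → subst (λ n′ → ∃[ ℓ ] MetricDimension {completeBinaryTree n′} ℓ (2 ^ (n ∸ 3)))
                 (m∸n+n≡m 3≤n) (lower-tight (n ∸ 3)))
  , (λ n 2≤n → subst (λ n′ → ∃[ ℓ ] MetricDimension {completeBinaryTree n′} ℓ (2 ^ (n ∸ 2)))
                 (m∸n+n≡m 2≤n) (upper-tight (n ∸ 2)))
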